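{- Let $n\geq 2$ and let $f=1^{x_{1}}0^{y_{1}}1^{x_{2}}0^{y_{2}}\cdots 1^{x_{n}}0^{y_{n}}$ with integers $x_i\geq 1$, $y_i\geq 1$ for $i=1,\ldots,n$. If $x_{1}\geq 2$ and $y_{n}\geq 2$, then $Q_{d}(f)\not\hookrightarrow Q_{d}$ for all $d\geq 2\sum_{i=1}^{n}(x_{i}+y_{i})-2$.
   Context: All strings are binary; $1^a$ (resp. $0^a$) denotes the string of $a$ consecutive ones (resp. zeros), and juxtaposition is concatenation. $Q_d$ is the $d$-dimensional hypercube: its vertices are the binary strings of length $d$, two being adjacent iff they differ in exactly one bit. A string $f$ is a factor of $\mu$ if $f$ appears as $|f|$ consecutive bits of $\mu$. The generalized Fibonacci cube $Q_d(f)$ is the subgraph of $Q_d$ induced by all strings of length $d$ that do not contain $f$ as a factor. A subgraph $H$ of a connected graph $G$ is an isometric subgraph, written $H\hookrightarrow G$ (and $H\not\hookrightarrow G$ otherwise), if $d_H(\mu,\nu)=d_G(\mu,\nu)$ for all $\mu,\nu\in V(H)$ (with $d_H=\infty$ for vertices in different components of $H$). -}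

module Defs where

open import Data.Bool.Base using (Bool; true; false)
open import Data.List.Base as List using (List; _++_; replicate; concat)
open import Data.List.Relation.Binary.Infix.Heterogeneous using (Infix)
open import Data.Nat.Base using (ℕ; zero; suc; _≤_)
open import Data.Product.Base using (_×_; _,_; ∃-syntax; proj₁; proj₂)
open import Data.Product using (∃!)
open import Data.Vec.Base using (Vec; lookup; toList)
open import Data.Vec.Functional using (Vector)
open import Relation.Binary.PropositionalEquality using (_≡_; _≢_; refl; ≢-sym)
open import Relation.Nullary.Construct.Add.Supremum using (_⁺; [_]; ⊤⁺)
open import Relation.Nullary.Negation.Core using (¬_)
open import Relation.Unary using (Pred; U)
open import Data.Unit.Base using (tt)
open import Level using (0ℓ)

-- Simple graphs whose vertices are drawn from an ambient type A.  Keeping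
-- the vertex set as a predicate on A lets a graph and its subgraph share
-- vertices literally, so that membership proofs never affect whether two
-- vertices are equal.
record Graph (A : Set) : Set₁ where
  field
    V        : Pred A 0ℓ
    E        : A → A → Set
    E⇒V      : ∀ {u v} → E u v → V u × V v
    E-sym    : ∀ {u v} → E u v → E v u
    E-irrefl : ∀ {u} → ¬ E u u

open Graph public

record _⊆ᴳ_ {A : Set} (H G : Graph A) : Set where
  field
    V⊆ : ∀ {u} → V H u → V G u
    E⊆ : ∀ {u v} → E H u v → E G u v

induced : {A : Set} → Graph A → Pred A 0ℓ → Graph A
induced G P = record
  { V        = λ u → V G u × P u
  ; E        = λ u v → E G u v × P u × P v
  ; E⇒V      = λ (e , pu , pv) → (proj₁ (E⇒V G e) , pu) , (proj₂ (E⇒V G e) , pv)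
  ; E-sym    = λ (e , pu , pv) → E-sym G e , pv , pu
  ; E-irrefl = λ (e , _) → E-irrefl G e
  }

induced-⊆ᴳ : {A : Set} (G : Graph A) (P : Pred A 0ℓ) → induced G P ⊆ᴳ G
induced-⊆ᴳ G P = record { V⊆ = proj₁ ; E⊆ = proj₁ }

data Walk {A : Set} (G : Graph A) : A → A → ℕ → Set where
  []  : ∀ {u} → V G u → Walk G u u zero
  _∷_ : ∀ {u v w k} → E G u v → Walk G v w k → Walk G u w (suc k)

-- IsDistance G u v δ means d_G(u,v) = δ, with ⊤⁺ in the role of ∞.
IsDistance : {A : Set} → Graph A → A → A → ℕ ⁺ → Set
IsDistance G u v [ k ] = Walk G u v k × (∀ j → Walk G u v j → k ≤ j)
IsDistance G u v ⊤⁺    = ∀ j → ¬ Walk G u v j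

infix 4 _⊆ᴳ_ _↪_ _↪̸_

_↪_ : {A : Set} → Graph A → Graph A → Set
H ↪ G = H ⊆ᴳ G ×
  (∀ μ ν → V H μ → V H ν → ∃[ δ ] IsDistance H μ ν δ × IsDistance G μ ν δ)

_↪̸_ : {A : Set} → Graph A → Graph A → Set
H ↪̸ G = ¬ (H ↪ G)

-- In binary strings, true is the bit 1 and false is the bit 0.
Q : (d : ℕ) → Graph (Vec Bool d)
Q d = record
  { V        = U
  ; E        = λ u v → ∃! _≡_ λ i → lookup u i ≢ lookup v i
  ; E⇒V      = λ _ → tt , tt
  ; E-sym    = λ (i , i≢ , unique) → i , ≢-sym i≢ , λ j≢ → unique (≢-sym j≢)
  ; E-irrefl = λ (_ , i≢ , _) → i≢ refl
  }

_IsFactorOf_ : {d : ℕ} → List Bool → Vec Bool d → Set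
f IsFactorOf μ = Infix _≡_ f (toList μ)

Q⟨_⟩ : (d : ℕ) → List Bool → Graph (Vec Bool d)
Q⟨ d ⟩ f = induced (Q d) (λ μ → ¬ (f IsFactorOf μ))

-- 1^{x₁} 0^{y₁} 1^{x₂} 0^{y₂} ⋯ 1^{xₙ} 0^{yₙ}
blocks : {n : ℕ} → Vector ℕ n → Vector ℕ n → List Bool
blocks x y = concat (List.tabulate λ i → replicate (x i) true ++ replicate (y i) false)

-- f begins with 11 and ends with 00, say f = 11c = e00.  The words e10c and
-- e01c are at distance 2 in the cube, and the two midpoints e00c and e11c of
-- the geodesics between them contain f.  Suppose f is a factor of eabc with
-- a ≠ b.  Then e = ls and c = tr with f = sabt and |l| = |t|; both s and t are
-- nonempty because a ≠ b.  The bits of f = sabt = ls00 = 11tr at (0-based)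
-- positions |l| and |l| + 1 are the first two of s00 and the last two of 11t.
-- If |s| ≥ 2 the second of them is both 1 and 0, and if |t| ≥ 2 the first is;
-- |f| ≥ 5 leaves no other case.  Since f begins with 1, padding the two words
-- on the left by zeros creates no new occurrence of f.
module Submission where

open import Defs
open import Data.Fin.Base using (zero; fromℕ)
open import Data.Nat.Base using (ℕ; suc; _+_; _*_; _∸_; _≥_)
open import Data.Nat.Properties using (+-0-commutativeMonoid)
open import Data.Vec.Functional using (Vector)
open import Algebra.Properties.CommutativeMonoid.Sum +-0-commutativeMonoid using (sum)

open import Data.Bool.Base using (Bool; true; false)
open import Data.Bool.Properties using (_≟_)
open import Data.Empty using (⊥)
import Data.Fin.Base as Fin
import Data.Fin.Properties as Finₚ
open import Data.List.Base using (List; []; _∷_; _++_; _∷ʳ_; length; replicate; initLast; _∷ʳ′_)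
open import Data.List.Properties using (++-assoc; ++-cancelˡ; ++-identityʳ; length-++; length-replicate; ∷-injective; ∷-injectiveˡ; ∷-injectiveʳ; ∷ʳ-injective; ∷ʳ-injectiveʳ)
open import Data.List.Relation.Binary.Infix.Heterogeneous using (Infix; here; there; MkView; toView; fromView)
import Data.List.Relation.Binary.Pointwise as Listᴾ
open import Data.List.Relation.Binary.Prefix.Heterogeneous using (_∷_)
open import Data.Nat.Base using (zero; _≤_; z≤n; s≤s)
open import Data.Nat.Properties using (≤-trans; m≤m+n; m≤n+m; +-mono-≤; +-comm; +-assoc; +-cancelʳ-≡; suc-injective; m∸n+n≡m)
open import Data.Nat.Tactic.RingSolver using (solve-∀)
open import Data.Product.Base using (_×_; _,_; ∃-syntax; proj₁; proj₂)
open import Data.Sum.Base using (_⊎_; inj₁; inj₂)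
open import Data.Unit.Base using (tt)
open import Data.Vec.Base as Vec using (Vec; []; _∷_; fromList; toList)
import Data.Vec.Properties as Vecₚ
open import Data.Vec.Properties using (toList-++; toList∘fromList)
open import Data.Vec.Relation.Binary.Pointwise.Extensional using (ext; extensional⇒inductive)
import Data.Vec.Relation.Binary.Pointwise.Inductive as Vecᴾ
open import Function.Base using (_∘_)
open import Relation.Binary.PropositionalEquality using (_≡_; _≢_; refl; sym; trans; cong; cong₂; subst; subst₂; module ≡-Reasoning)
open import Relation.Nullary.Construct.Add.Supremum using ([_]; ⊤⁺)
open import Relation.Nullary.Decidable using (decidable-stable)
open import Relation.Nullary.Negation using (¬_; contradiction)

pattern 𝟙 = true
pattern 𝟘 = false

-- Equal concatenations of lists

private variable
  A : Set
  ws xs ys zs : List A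

++-injective : length xs ≡ length ys → xs ++ ws ≡ ys ++ zs → xs ≡ ys × ws ≡ zs
++-injective {xs = []}     {[]}     _   eq = refl , eq
++-injective {xs = x ∷ xs} {y ∷ ys} len eq with ∷-injective eq
... | refl , eq′ with ++-injective {xs = xs} {ys} (suc-injective len) eq′
... | refl , eq″ = refl , eq″

++-overlap : length xs ≤ length ys → ys ++ ws ≡ xs ++ zs →
             ∃[ vs ] (ys ≡ xs ++ vs × vs ++ ws ≡ zs)
++-overlap {xs = []}     {ys}     _         eq = ys , refl , eq
++-overlap {xs = x ∷ xs} {y ∷ ys} (s≤s len) eq with ∷-injective eq
... | refl , eq′ with ++-overlap {xs = xs} {ys} len eq′
... | vs , refl , eq″ = vs , refl , eq″

length-∷ʳ : ∀ (xs : List A) x → length (xs ∷ʳ x) ≡ suc (length xs)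
length-∷ʳ xs x = trans (length-++ xs) (+-comm (length xs) 1)

-- Occurrences of `f` across the middle of `eabc`

-- The cases are `s` of length 0, 1 and at least 2. The bound 5 is sharp: `f = 1100` occurs in
-- `111000`, with `l = s = 1`, `ab = 10` and `t = r = 0`.
no-overlap : ∀ l s t r {a b} → a ≢ b → length l ≡ length t →
             5 ≤ length (s ++ a ∷ b ∷ t) →
             s ++ a ∷ b ∷ t ≡ l ++ s ++ 𝟘 ∷ 𝟘 ∷ [] →
             s ++ a ∷ b ∷ t ≡ 𝟙 ∷ 𝟙 ∷ t ++ r → ⊥
no-overlap l [] t r a≢b _ _ _ eq₂ with ∷-injective eq₂
... | refl , eq₃ = a≢b (sym (∷-injectiveˡ eq₃))
-- Here `s` is the single bit 1, so `5 ≤ |f|` forces `t` to end in two bits `u`, `v`. The bit `u` is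
-- next to last in `f`, hence 0; in `11tr` it stands at position `|l|`, where `ls00` has the bit 1
-- of `s`.
no-overlap l (p ∷ []) t r _ _ _ _ eq₂ with ∷-injective eq₂
... | refl , _ with initLast t
no-overlap _ (_ ∷ []) _ _ _ _ (s≤s (s≤s (s≤s ()))) _ _ | refl , _ | []
... | t′ ∷ʳ′ v with initLast t′
no-overlap _ (_ ∷ []) _ _ _ _ (s≤s (s≤s (s≤s (s≤s ())))) _ _ | refl , _ | _ ∷ʳ′ v | []
no-overlap l (_ ∷ []) _ r {a} {b} _ |l|≡|t| _ eq₁ eq₂ | refl , _ | _ ∷ʳ′ v | t ∷ʳ′ u =
  contradiction (trans (sym u≡𝟙) u≡𝟘) λ ()
  where
  open ≡-Reasoning
  u≡𝟘 : u ≡ 𝟘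
  u≡𝟘 = ∷ʳ-injectiveʳ (𝟙 ∷ a ∷ b ∷ t) (l ∷ʳ 𝟙)
    (proj₁ (∷ʳ-injective (𝟙 ∷ a ∷ b ∷ t ∷ʳ u) (l ∷ʳ 𝟙 ∷ʳ 𝟘) (begin
      𝟙 ∷ a ∷ b ∷ t ∷ʳ u ∷ʳ v    ≡⟨ eq₁ ⟩
      l ++ 𝟙 ∷ 𝟘 ∷ 𝟘 ∷ []        ≡⟨ ++-assoc l (𝟙 ∷ []) _ ⟨
      l ∷ʳ 𝟙 ++ 𝟘 ∷ 𝟘 ∷ []       ≡⟨ ++-assoc (l ∷ʳ 𝟙) (𝟘 ∷ []) _ ⟨
      l ∷ʳ 𝟙 ∷ʳ 𝟘 ∷ʳ 𝟘           ∎)))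
  |11t|≡|l| : 2 + length t ≡ length l
  |11t|≡|l| = begin
    2 + length t             ≡⟨ cong suc (length-∷ʳ t u) ⟨
    suc (length (t ∷ʳ u))    ≡⟨ length-∷ʳ (t ∷ʳ u) v ⟨
    length (t ∷ʳ u ∷ʳ v)     ≡⟨ |l|≡|t| ⟨
    length l                 ∎
  u≡𝟙 : u ≡ 𝟙
  u≡𝟙 = ∷-injectiveˡ (proj₂ (++-injective {xs = 𝟙 ∷ 𝟙 ∷ t} |11t|≡|l| (begin
    𝟙 ∷ 𝟙 ∷ t ++ u ∷ v ∷ r          ≡⟨ ++-assoc (𝟙 ∷ 𝟙 ∷ t) (u ∷ []) _ ⟨
    𝟙 ∷ 𝟙 ∷ (t ∷ʳ u) ++ v ∷ r       ≡⟨ ++-assoc (𝟙 ∷ 𝟙 ∷ (t ∷ʳ u)) (v ∷ []) r ⟨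
    𝟙 ∷ 𝟙 ∷ (t ∷ʳ u ∷ʳ v) ++ r      ≡⟨ eq₂ ⟨
    𝟙 ∷ a ∷ b ∷ t ∷ʳ u ∷ʳ v         ≡⟨ eq₁ ⟩
    l ++ 𝟙 ∷ 𝟘 ∷ 𝟘 ∷ []             ∎)))
-- Here `s` begins with 11. If `t` is nonempty, its last bit `y` is the last bit of `f`, hence 0; in
-- `11tr` it stands at position `|l| + 1`, where `ls00` has the second 1 of `s`.
no-overlap l (p ∷ q ∷ s) t r _ _ _ _ eq₂ with ∷-injective eq₂
... | refl , eq₃ with ∷-injectiveˡ eq₃ | initLast t
-- With `t` empty, `l` is empty as well, so `sab = s00` and `a` equals `b`.
no-overlap [] (p ∷ q ∷ s) _ _ a≢b _ _ eq₁ _ | refl , _ | refl | [] =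
  a≢b (trans (∷-injectiveˡ ab≡00) (sym (∷-injectiveˡ (∷-injectiveʳ ab≡00))))
  where ab≡00 = ++-cancelˡ (p ∷ q ∷ s) _ _ eq₁
no-overlap l (p ∷ q ∷ s) _ r {a} {b} _ |l|≡|t| _ eq₁ eq₂ | refl , _ | refl | t ∷ʳ′ y =
  contradiction (trans 𝟙≡y y≡𝟘) λ ()
  where
  open ≡-Reasoning
  y≡𝟘 : y ≡ 𝟘
  y≡𝟘 = ∷ʳ-injectiveʳ (𝟙 ∷ 𝟙 ∷ s ++ a ∷ b ∷ t) ((l ++ 𝟙 ∷ 𝟙 ∷ s) ∷ʳ 𝟘) (begin
    (𝟙 ∷ 𝟙 ∷ s ++ a ∷ b ∷ t) ∷ʳ y     ≡⟨ ++-assoc (𝟙 ∷ 𝟙 ∷ s) (a ∷ b ∷ t) _ ⟩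
    𝟙 ∷ 𝟙 ∷ s ++ a ∷ b ∷ t ∷ʳ y       ≡⟨ eq₁ ⟩
    l ++ 𝟙 ∷ 𝟙 ∷ s ++ 𝟘 ∷ 𝟘 ∷ []      ≡⟨ ++-assoc l (𝟙 ∷ 𝟙 ∷ s) _ ⟨
    (l ++ 𝟙 ∷ 𝟙 ∷ s) ++ 𝟘 ∷ 𝟘 ∷ []    ≡⟨ ++-assoc (l ++ 𝟙 ∷ 𝟙 ∷ s) (𝟘 ∷ []) _ ⟨
    (l ++ 𝟙 ∷ 𝟙 ∷ s) ∷ʳ 𝟘 ∷ʳ 𝟘        ∎)
  |l1|≡|11t| : length (l ∷ʳ 𝟙) ≡ 2 + length t
  |l1|≡|11t| = begin
    length (l ∷ʳ 𝟙)          ≡⟨ length-∷ʳ l 𝟙 ⟩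
    suc (length l)           ≡⟨ cong suc |l|≡|t| ⟩
    suc (length (t ∷ʳ y))    ≡⟨ cong suc (length-∷ʳ t y) ⟩
    2 + length t             ∎
  𝟙≡y : 𝟙 ≡ y
  𝟙≡y = ∷-injectiveˡ (proj₂ (++-injective {xs = l ∷ʳ 𝟙} {ys = 𝟙 ∷ 𝟙 ∷ t} |l1|≡|11t| (begin
    l ∷ʳ 𝟙 ++ 𝟙 ∷ s ++ 𝟘 ∷ 𝟘 ∷ []     ≡⟨ ++-assoc l (𝟙 ∷ []) _ ⟩
    l ++ 𝟙 ∷ 𝟙 ∷ s ++ 𝟘 ∷ 𝟘 ∷ []      ≡⟨ eq₁ ⟨
    𝟙 ∷ 𝟙 ∷ s ++ a ∷ b ∷ t ∷ʳ y       ≡⟨ eq₂ ⟩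
    𝟙 ∷ 𝟙 ∷ (t ∷ʳ y) ++ r             ≡⟨ ++-assoc (𝟙 ∷ 𝟙 ∷ t) (y ∷ []) r ⟩
    𝟙 ∷ 𝟙 ∷ t ++ y ∷ r                ∎)))

infix⇒++ : Infix _≡_ xs ws → ∃[ l ] ∃[ r ] ws ≡ l ++ xs ++ r
infix⇒++ inf with toView inf
... | MkView l xs≋ r with Listᴾ.Pointwise-≡⇒≡ xs≋
... | refl = l , r , refl

++⇒infix : ∀ (l xs r : List A) → Infix _≡_ xs (l ++ xs ++ r)
++⇒infix l xs r = fromView (MkView l (Listᴾ.≡⇒Pointwise-≡ refl) r)

-- Since `|f| = |e| + 2 = |c| + 2`, an occurrence of `f` starts at position at most `|e|` and ends
-- no earlier than `b`. It therefore covers both `a` and `b`, which gives the splittings `e = ls`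
-- and `c = tr`.
not-infix : ∀ {f} e c {a b} → f ≡ e ++ 𝟘 ∷ 𝟘 ∷ [] → f ≡ 𝟙 ∷ 𝟙 ∷ c → 5 ≤ length f → a ≢ b →
            ¬ Infix _≡_ f (e ++ a ∷ b ∷ c)
not-infix {f} e c {a} {b} f≡e00 f≡11c 5≤|f| a≢b inf with infix⇒++ inf
... | l , r , eq with ++-overlap {xs = l} {ys = e} |l|≤|e| eq
  where
  open ≡-Reasoning
  |l|+|r|≡|e| : length l + length r ≡ length e
  |l|+|r|≡|e| = +-cancelʳ-≡ (2 + length c) _ _ (begin
    length l + length r + (2 + length c)      ≡⟨ rotate (length l) (length r) (2 + length c) ⟩
    length l + (2 + length c + length r)      ≡⟨ cong (λ f → length l + (length f + length r)) f≡11c ⟨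
    length l + (length f + length r)          ≡⟨ cong (length l +_) (length-++ f) ⟨
    length l + length (f ++ r)                ≡⟨ length-++ l ⟨
    length (l ++ f ++ r)                      ≡⟨ cong length eq ⟨
    length (e ++ a ∷ b ∷ c)                   ≡⟨ length-++ e ⟩
    length e + (2 + length c)                 ∎)
    where
    rotate : ∀ x y z → x + y + z ≡ x + (z + y)
    rotate = solve-∀
  |l|≤|e| : length l ≤ length e
  |l|≤|e| = subst (length l ≤_) |l|+|r|≡|e| (m≤m+n _ _)
... | s , refl , sabc≡fr
  with ++-overlap {xs = s ++ a ∷ b ∷ []} {ys = f} |sab|≤|f| (sym (trans (++-assoc s _ c) sabc≡fr))
  where
  open ≡-Reasoning
  |f| : length f ≡ length l + length (s ++ a ∷ b ∷ [])
  |f| = begin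
    length f                                ≡⟨ cong length (trans f≡e00 (++-assoc l s _)) ⟩
    length (l ++ s ++ 𝟘 ∷ 𝟘 ∷ [])           ≡⟨ length-++ l ⟩
    length l + length (s ++ 𝟘 ∷ 𝟘 ∷ [])     ≡⟨ cong (length l +_) (length-++ s) ⟩
    length l + (length s + 2)               ≡⟨ cong (length l +_) (length-++ s) ⟨
    length l + length (s ++ a ∷ b ∷ [])     ∎
  |sab|≤|f| : length (s ++ a ∷ b ∷ []) ≤ length f
  |sab|≤|f| = subst (_ ≤_) (sym |f|) (m≤n+m _ (length l))
... | t , f≡sabt , refl =
  no-overlap l s t r a≢b |l|≡|t| (subst (λ z → 5 ≤ length z) f≡sabt′ 5≤|f|)
    (trans (sym f≡sabt′) (trans f≡e00 (++-assoc l s _))) (trans (sym f≡sabt′) f≡11c)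
  where
  f≡sabt′ : f ≡ s ++ a ∷ b ∷ t
  f≡sabt′ = trans f≡sabt (++-assoc s _ t)
  |l|≡|t| : length l ≡ length t
  |l|≡|t| = +-cancelʳ-≡ (length s + 2) _ _ (begin
    length l + (length s + 2)                 ≡⟨ cong (length l +_) (length-++ s) ⟨
    length l + length (s ++ 𝟘 ∷ 𝟘 ∷ [])       ≡⟨ length-++ l ⟨
    length (l ++ s ++ 𝟘 ∷ 𝟘 ∷ [])             ≡⟨ cong length (++-assoc l s _) ⟨
    length ((l ++ s) ++ 𝟘 ∷ 𝟘 ∷ [])           ≡⟨ cong length (trans (sym f≡e00) f≡sabt) ⟩
    length ((s ++ a ∷ b ∷ []) ++ t)           ≡⟨ length-++ (s ++ a ∷ b ∷ []) ⟩
    length (s ++ a ∷ b ∷ []) + length t       ≡⟨ cong (_+ length t) (length-++ s) ⟩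
    length s + 2 + length t                   ≡⟨ +-comm _ (length t) ⟩
    length t + (length s + 2)                 ∎)
    where open ≡-Reasoning

not-infix-padded : ∀ k {c w} → ¬ Infix _≡_ (𝟙 ∷ c) w → ¬ Infix _≡_ (𝟙 ∷ c) (replicate k 𝟘 ++ w)
not-infix-padded zero    ¬inf inf            = ¬inf inf
not-infix-padded (suc k) ¬inf (here (() ∷ _))
not-infix-padded (suc k) ¬inf (there inf)    = not-infix-padded k ¬inf inf

-- Edges of the hypercube, bit by bit

-- The unique differing position is the head or lies in the tail. Uniqueness only refutes a
-- difference elsewhere; decidable equality of bits turns this into equality.
edge-uncons : ∀ {d a b} {u v : Vec Bool d} → E (Q (suc d)) (a ∷ u) (b ∷ v) →
              (a ≢ b × u ≡ v) ⊎ (a ≡ b × E (Q d) u v)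
edge-uncons (Fin.zero , a≢b , unique) = inj₁ (a≢b , Vecᴾ.Pointwise-≡⇒≡ (extensional⇒inductive (ext λ j →
  decidable-stable (_ ≟ _) λ u≢v → contradiction (unique {Fin.suc j} u≢v) λ ())))
edge-uncons (Fin.suc i , u≢v , unique) = inj₂
  ( decidable-stable (_ ≟ _) (λ a≢b → contradiction (unique {Fin.zero} a≢b) λ ())
  , i , u≢v , λ {j} ≢j → Finₚ.suc-injective (unique {Fin.suc j} ≢j))

edge-here : ∀ {d a b} (u : Vec Bool d) → a ≢ b → E (Q (suc d)) (a ∷ u) (b ∷ u)
edge-here {d} {a} {b} u a≢b = Fin.zero , a≢b , unique
  where
  unique : ∀ {j : Fin.Fin (suc d)} → Vec.lookup (a ∷ u) j ≢ Vec.lookup (b ∷ u) j → Fin.zero ≡ j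
  unique {Fin.zero}  _   = refl
  unique {Fin.suc j} u≢u = contradiction refl u≢u

edge-there : ∀ {d} a (u v : Vec Bool d) → E (Q d) u v → E (Q (suc d)) (a ∷ u) (a ∷ v)
edge-there {d} a u v (i , u≢v , unique) = Fin.suc i , u≢v , unique′
  where
  unique′ : ∀ {j : Fin.Fin (suc d)} → Vec.lookup (a ∷ u) j ≢ Vec.lookup (a ∷ v) j → Fin.suc i ≡ j
  unique′ {Fin.zero}  a≢a = contradiction refl a≢a
  unique′ {Fin.suc j} ≢j  = cong Fin.suc (unique ≢j)

edge-++ : ∀ {m d} (p : Vec Bool m) (u v : Vec Bool d) → E (Q d) u v →
          E (Q (m + d)) (p Vec.++ u) (p Vec.++ v)
edge-++ []      u v e = e
edge-++ (a ∷ p) u v e = edge-there a _ _ (edge-++ p u v e)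

-- Squares of the cube with two opposite corners removed

infixr 5 _⟨_,_⟩_

-- For fixed `p` and `q` these are the four corners of a square, with `10` opposite to `01`.
_⟨_,_⟩_ : ∀ {m n} → Vec Bool m → Bool → Bool → Vec Bool n → Vec Bool (m + (2 + n))
p ⟨ a , b ⟩ q = p Vec.++ a ∷ b ∷ q

⟨10⟩≢⟨01⟩ : ∀ {m n} (p : Vec Bool m) {q : Vec Bool n} → p ⟨ 𝟙 , 𝟘 ⟩ q ≢ p ⟨ 𝟘 , 𝟙 ⟩ q
⟨10⟩≢⟨01⟩ []      ()
⟨10⟩≢⟨01⟩ (_ ∷ p) eq = ⟨10⟩≢⟨01⟩ p (Vecₚ.∷-injectiveʳ eq)

¬edge-10-01 : ∀ {m n} (p : Vec Bool m) (q : Vec Bool n) → ¬ E (Q _) (p ⟨ 𝟙 , 𝟘 ⟩ q) (p ⟨ 𝟘 , 𝟙 ⟩ q)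
¬edge-10-01 [] q e with edge-uncons e
... | inj₁ (_ , ())
... | inj₂ (() , _)
¬edge-10-01 (_ ∷ p) q e with edge-uncons e
... | inj₁ (a≢a , _) = a≢a refl
... | inj₂ (_ , e′)  = ¬edge-10-01 p q e′

-- Both ends share the bits of `p`, so flipping one of these would cost a second edge to flip it
-- back and leave none for the middle. In the base case the order of the two flips decides between
-- `00` and `11`.
midpoint-10-01 : ∀ {m n} (p : Vec Bool m) (q : Vec Bool n) w →
                 E (Q _) (p ⟨ 𝟙 , 𝟘 ⟩ q) w → E (Q _) w (p ⟨ 𝟘 , 𝟙 ⟩ q) →
                 w ≡ p ⟨ 𝟘 , 𝟘 ⟩ q ⊎ w ≡ p ⟨ 𝟙 , 𝟙 ⟩ q
midpoint-10-01 [] q (a ∷ w) e₁ e₂ with edge-uncons e₁ | edge-uncons e₂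
midpoint-10-01 [] q (𝟙 ∷ w) e₁ e₂ | inj₁ (1≢1 , _) | _ = contradiction refl 1≢1
midpoint-10-01 [] q (𝟘 ∷ w) e₁ e₂ | inj₁ (_ , refl) | _ = inj₁ refl
... | inj₂ (refl , _) | inj₁ (_ , refl) = inj₂ refl
... | inj₂ (refl , _) | inj₂ (() , _)
midpoint-10-01 (x ∷ p) q (a ∷ w) e₁ e₂ with edge-uncons e₁ | edge-uncons e₂
... | inj₁ (_ , refl)   | inj₁ (_ , eq)     = contradiction eq (⟨10⟩≢⟨01⟩ p)
... | inj₁ (x≢a , _)    | inj₂ (a≡x , _)    = contradiction (sym a≡x) x≢a
... | inj₂ (x≡a , _)    | inj₁ (a≢x , _)    = contradiction (sym x≡a) a≢x
... | inj₂ (refl , e₁′) | inj₂ (_ , e₂′) with midpoint-10-01 p q w e₁′ e₂′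
...   | inj₁ refl = inj₁ refl
...   | inj₂ refl = inj₂ refl

geodesic-10-01 : ∀ {m n} (p : Vec Bool m) (q : Vec Bool n) → Walk (Q _) (p ⟨ 𝟙 , 𝟘 ⟩ q) (p ⟨ 𝟘 , 𝟙 ⟩ q) 2
geodesic-10-01 p q =
  _∷_ {v = p ⟨ 𝟘 , 𝟘 ⟩ q} (edge-++ p (𝟙 ∷ 𝟘 ∷ q) (𝟘 ∷ 𝟘 ∷ q) (edge-here (𝟘 ∷ q) λ ()))
    (edge-++ p (𝟘 ∷ 𝟘 ∷ q) (𝟘 ∷ 𝟙 ∷ q) (edge-there 𝟘 (𝟘 ∷ q) (𝟙 ∷ q) (edge-here q λ ())) ∷ [] tt)

module _ {f : List Bool} {m n} (p : Vec Bool m) (q : Vec Bool n)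
         (f∈00 : f IsFactorOf (p ⟨ 𝟘 , 𝟘 ⟩ q)) (f∈11 : f IsFactorOf (p ⟨ 𝟙 , 𝟙 ⟩ q))
         where

  -- The endpoints enter through equations because matching `[]` against the words themselves would
  -- require unifying two applications of `_⟨_,_⟩_`.
  no-short-walk : ∀ {k u v} → k ≤ 2 → u ≡ p ⟨ 𝟙 , 𝟘 ⟩ q → v ≡ p ⟨ 𝟘 , 𝟙 ⟩ q → ¬ Walk (Q⟨ _ ⟩ f) u v k
  no-short-walk _ u≡ v≡ ([] _) = ⟨10⟩≢⟨01⟩ p (trans (sym u≡) v≡)
  no-short-walk _ refl refl ((e , _) ∷ [] _) = ¬edge-10-01 p q e
  no-short-walk _ refl refl (_∷_ {v = w} (e₁ , _ , f∉w) ((e₂ , _) ∷ [] _)) with midpoint-10-01 p q w e₁ e₂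
  ... | inj₁ refl = f∉w f∈00
  ... | inj₂ refl = f∉w f∈11
  no-short-walk (s≤s (s≤s ())) _ _ (_ ∷ _ ∷ _ ∷ _)

  blocked-square⇒↪̸ : ¬ f IsFactorOf (p ⟨ 𝟙 , 𝟘 ⟩ q) → ¬ f IsFactorOf (p ⟨ 𝟘 , 𝟙 ⟩ q) →
                      Q⟨ m + (2 + n) ⟩ f ↪̸ Q (m + (2 + n))
  blocked-square⇒↪̸ f∉10 f∉01 (_ , distances)
    with distances (p ⟨ 𝟙 , 𝟘 ⟩ q) (p ⟨ 𝟘 , 𝟙 ⟩ q) (tt , f∉10) (tt , f∉01)
  -- Both graphs share one distance. The walk through `00` in the cube bounds it by 2, and in the
  -- next case shows that it is not infinite.
  ... | [ k ] , (walk , _) , (_ , shortest) = no-short-walk (shortest 2 (geodesic-10-01 p q)) refl refl walk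
  ... | ⊤⁺    , _ , ¬walk                   = ¬walk 2 (geodesic-10-01 p q)

-- Padding the square to dimension `d`

11⋯00⇒↪̸ : ∀ {f} e c → f ≡ e ++ 𝟘 ∷ 𝟘 ∷ [] → f ≡ 𝟙 ∷ 𝟙 ∷ c → 5 ≤ length f →
           ∀ d → d ≥ 2 * length f ∸ 2 → Q⟨ d ⟩ f ↪̸ Q d
11⋯00⇒↪̸ {f} e c f≡e00 f≡11c 5≤|f| d d≥ =
  subst (λ d → Q⟨ d ⟩ f ↪̸ Q d) |p|+2+|c|≡d
    (blocked-square⇒↪̸ (fromList p) (fromList c)
      -- The two removed corners contain `f` because `e00c = fc` and `e11c = ef`.
      (in-word (subst (Infix _≡_ f) 00-word (++⇒infix (replicate k 𝟘) f c)))
      (in-word (subst (Infix _≡_ f) 11-word (++⇒infix p f [])))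
      (not-in-word (λ ())) (not-in-word (λ ())))
  where
  open ≡-Reasoning
  -- Both `e` and `c` have length `|f| - 2`, so `eabc` has length `2|f| - 2`; zeros fill the rest of
  -- `d`.
  k = d ∸ (2 * length f ∸ 2)
  p = replicate k 𝟘 ++ e

  toList-word : ∀ {a b} → toList (fromList p ⟨ a , b ⟩ fromList c) ≡ p ++ a ∷ b ∷ c
  toList-word {a} {b} = trans (toList-++ (fromList p) _)
    (cong₂ (λ u v → u ++ a ∷ b ∷ v) (toList∘fromList p) (toList∘fromList c))

  in-word : ∀ {a b} → Infix _≡_ f (p ++ a ∷ b ∷ c) → f IsFactorOf (fromList p ⟨ a , b ⟩ fromList c)
  in-word = subst (Infix _≡_ f) (sym toList-word)

  00-word : replicate k 𝟘 ++ f ++ c ≡ p ++ 𝟘 ∷ 𝟘 ∷ c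
  00-word = begin
    replicate k 𝟘 ++ f ++ c                       ≡⟨ cong (λ f → replicate k 𝟘 ++ f ++ c) f≡e00 ⟩
    replicate k 𝟘 ++ (e ++ 𝟘 ∷ 𝟘 ∷ []) ++ c       ≡⟨ cong (replicate k 𝟘 ++_) (++-assoc e _ c) ⟩
    replicate k 𝟘 ++ e ++ 𝟘 ∷ 𝟘 ∷ c               ≡⟨ ++-assoc (replicate k 𝟘) e _ ⟨
    p ++ 𝟘 ∷ 𝟘 ∷ c                                ∎

  11-word : p ++ f ++ [] ≡ p ++ 𝟙 ∷ 𝟙 ∷ c
  11-word = cong (p ++_) (trans (++-identityʳ f) f≡11c)

  not-in-word : ∀ {a b} → a ≢ b → ¬ f IsFactorOf (fromList p ⟨ a , b ⟩ fromList c)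
  -- Writing `f` as `11c` exposes its leading 1, which no padding zero matches.
  not-in-word a≢b inf = not-infix-padded k
    (not-infix e c f≡e00 f≡11c 5≤|f| a≢b ∘ subst (λ f → Infix _≡_ f _) (sym f≡11c))
    (subst₂ (Infix _≡_) f≡11c (trans toList-word (++-assoc (replicate k 𝟘) e _)) inf)

  2|f|∸2 : length e + (2 + length c) ≡ 2 * length f ∸ 2
  2|f|∸2 = begin
    length e + (2 + length c)                 ≡⟨ cong (λ f → length e + length f) f≡11c ⟨
    length e + length f                       ≡⟨⟩
    -- The added 2 joins `|e|` to make `|e00| = |f|`; the `+ 0` comes from unfolding `2 * length f`.
    2 + (length e + length f) ∸ 2             ≡⟨ cong (_∸ 2) (shift (length e) (length f)) ⟩
    length e + 2 + (length f + 0) ∸ 2         ≡⟨ cong (λ z → z + (length f + 0) ∸ 2) (length-++ e) ⟨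
    length (e ++ 𝟘 ∷ 𝟘 ∷ []) + (length f + 0) ∸ 2  ≡⟨ cong (λ g → length g + (length f + 0) ∸ 2) f≡e00 ⟨
    2 * length f ∸ 2                          ∎
    where
    shift : ∀ x y → 2 + (x + y) ≡ x + 2 + (y + 0)
    shift = solve-∀

  |p|+2+|c|≡d : length p + (2 + length c) ≡ d
  |p|+2+|c|≡d = begin
    length p + (2 + length c)                  ≡⟨ cong (_+ (2 + length c)) (length-++ (replicate k 𝟘)) ⟩
    |0ᵏ| + length e + (2 + length c)           ≡⟨ +-assoc |0ᵏ| (length e) (2 + length c) ⟩
    |0ᵏ| + (length e + (2 + length c))         ≡⟨ cong₂ _+_ (length-replicate k) 2|f|∸2 ⟩
    k + (2 * length f ∸ 2)                     ≡⟨ m∸n+n≡m d≥ ⟩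
    d                                          ∎
    where |0ᵏ| = length (replicate k 𝟘)

-- The ends and the length of the block word

replicate-≥2 : ∀ {k} (a : A) → k ≥ 2 → ∃[ w ] replicate k a ≡ a ∷ a ∷ w
replicate-≥2 a (s≤s (s≤s _)) = _ , refl

replicate-≥2ʳ : ∀ {k} (a : A) → k ≥ 2 → ∃[ w ] replicate k a ≡ w ++ a ∷ a ∷ []
replicate-≥2ʳ {k = suc (suc zero)}    a _                   = [] , refl
replicate-≥2ʳ {k = suc (suc (suc k))} a (s≤s (s≤s _)) with replicate-≥2ʳ {k = suc (suc k)} a (s≤s (s≤s z≤n))
... | w , eq = a ∷ w , cong (a ∷_) eq
replicate-≥2ʳ {k = suc zero} a (s≤s ())

blocks-head : ∀ {n} (x y : Vector ℕ (suc n)) → x zero ≥ 2 → ∃[ c ] blocks x y ≡ 𝟙 ∷ 𝟙 ∷ c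
blocks-head x y x≥2 with replicate-≥2 𝟙 x≥2
... | w , eq = _ , cong (λ z → (z ++ replicate (y zero) 𝟘) ++ blocks (x ∘ Fin.suc) (y ∘ Fin.suc)) eq

blocks-last : ∀ n (x y : Vector ℕ (suc n)) → y (fromℕ n) ≥ 2 → ∃[ e ] blocks x y ≡ e ++ 𝟘 ∷ 𝟘 ∷ []
blocks-last zero x y y≥2 with replicate-≥2ʳ 𝟘 y≥2
... | w , eq = replicate (x zero) 𝟙 ++ w ,
  trans (++-identityʳ _)
    (trans (cong (replicate (x zero) 𝟙 ++_) eq) (sym (++-assoc (replicate (x zero) 𝟙) w _)))
blocks-last (suc n) x y y≥2 with blocks-last n (x ∘ Fin.suc) (y ∘ Fin.suc) y≥2
... | e , eq = first ++ e , trans (cong (first ++_) eq) (sym (++-assoc first e _))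
  where first = replicate (x zero) 𝟙 ++ replicate (y zero) 𝟘

length-blocks : ∀ n (x y : Vector ℕ n) → length (blocks x y) ≡ sum (λ i → x i + y i)
length-blocks zero    x y = refl
length-blocks (suc n) x y = trans (length-++ (replicate (x zero) 𝟙 ++ _))
  (cong₂ _+_
    (trans (length-++ (replicate (x zero) 𝟙))
           (cong₂ _+_ (length-replicate (x zero)) (length-replicate (y zero))))
    (length-blocks n (x ∘ Fin.suc) (y ∘ Fin.suc)))

lemma2p1 : ∀ (m : ℕ) → let n = 2 + m in
    (x y : Vector ℕ n) →
    (∀ i → x i ≥ 1) → (∀ i → y i ≥ 1) →
    x zero ≥ 2 → y (fromℕ (1 + m)) ≥ 2 →
    ∀ (d : ℕ) → d ≥ 2 * sum (λ i → x i + y i) ∸ 2 →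
    Q⟨ d ⟩ (blocks x y) ↪̸ Q d
lemma2p1 m x y x≥1 y≥1 x₁≥2 yₙ≥2 d d≥
  with blocks-head x y x₁≥2 | blocks-last (suc m) x y yₙ≥2
... | c , f≡11c | e , f≡e00 =
  11⋯00⇒↪̸ e c f≡e00 f≡11c (subst (5 ≤_) (sym |f|) 5≤sum) d (subst (λ z → d ≥ 2 * z ∸ 2) (sym |f|) d≥)
  where
  |f| = length-blocks (2 + m) x y
  second = Fin.suc Fin.zero
  5≤sum : 5 ≤ sum (λ i → x i + y i)
  -- The first block contributes at least 2 + 1 and the second at least 1 + 1.
  5≤sum = +-mono-≤ (+-mono-≤ x₁≥2 (y≥1 zero))
    (≤-trans (+-mono-≤ (x≥1 second) (y≥1 second)) (m≤m+n _ _))
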